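{- Let $B_k(\alpha)$ ($1\le k\le3$) and $D_{k,i}(\beta)$ ($1\le k\le8$, $1\le i\le\lfloor k/3\rfloor$) be the integer sequences defined in the context. Then for every integer $m\ge2$: (a) for every $1\le k\le3$ there is an integer $\alpha\ge1$ with $B_k(2\alpha-1)\equiv0\pmod m$ (that is, $\mu_m(k)=\min\{\alpha\ge1: B_k(2\alpha-1)\equiv0\pmod m\}$ exists); (b) for every $1\le k\le8$ there is an integer $\beta\ge1$ such that $D_{k,i}(2\beta-1)\equiv0\pmod m$ simultaneously for all $1\le i\le\lfloor k/3\rfloor$ (that is, $\nu_m(k)=\min\{\beta\ge1: D_{k,i}(2\beta-1)\equiv0\pmod m \text{ for } 1\le i\le\lfloor k/3\rfloor\}$ exists).
   Context: The sequences $B_k(\alpha)$ ($\alpha\ge0$) satisfy $B_k(\alpha+4)=f(k)B_k(\alpha+2)+g(k)B_k(\alpha)$ for $\alpha\ge0$, where $f(1)=-8,\ g(1)=0$; $f(2)=104,\ g(2)=-2^{14}$; $f(3)=-3520,\ g(3)=-2^{22}$, with initial values $(B_k(0),B_k(1),B_k(2),B_k(3))$: $B_1:(0,0,0,0)$; $B_2:(0,1,-2048,104)$; $B_3:(0,-24,49152,84480)$. The sequences $D_{k,i}(\beta)$ ($\beta\ge0$) satisfy $D_{k,i}(\beta+4)=h(k)D_{k,i}(\beta+2)+r(k)D_{k,i}(\beta)$ for $\beta\ge0$, with the following coefficients and initial values $(D_{k,i}(0),D_{k,i}(1),D_{k,i}(2),D_{k,i}(3))$: $k=3$: $h=-12$,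 $r=-3^7$; $D_{3,1}:(0,1,-243,-12)$. $k=4$: $h=-2\cdot3^2\cdot19$, $r=-3^{10}$; $D_{4,1}:(0,-12,2916,4104)$. $k=5$: $h=2^2\cdot3^3\cdot17$, $r=-3^{13}$; $D_{5,1}:(0,90,-21870,165240)$. $k=6$: $h=-2\cdot3^2\cdot17\cdot23$, $r=-3^{16}$; $D_{6,1}:(0,-486,118098,3420468)$; $D_{6,2}:(0,1,-177147,-7038)$. $k=7$: $h=2^2\cdot3^3\cdot491$, $r=-3^{19}$; $D_{7,1}:(0,1701,-413343,90200628)$; $D_{7,2}:(0,-21,3720087,-1113588)$. $k=8$: $h=-2\cdot3^4\cdot5\cdot359$, $r=-3^{22}$; $D_{8,1}:(0,0,0,0)$; $D_{8,2}:(0,252,-44641044,-73279080)$. For $k=1,2$ there are no sequences $D_{k,i}$ and condition (b) is vacuous. -}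

module Defs where

open import Data.Integer.Base using (ℤ; +_; -_; _+_; _*_; 0ℤ)
open import Data.Nat.Base as ℕ using (ℕ; suc; _^_)
open import Data.Product.Base using (_×_)

recurrence : (p q a b c d : ℤ) → ℕ → ℤ
recurrence p q a b c d 0 = a
recurrence p q a b c d 1 = b
recurrence p q a b c d 2 = c
recurrence p q a b c d 3 = d
recurrence p q a b c d (suc (suc (suc (suc n)))) =
  p * recurrence p q a b c d (suc (suc n)) + q * recurrence p q a b c d n

-- In the tables below the indices are the mathematical ones (starting at 1);
-- the final catch-all clauses are junk values at indices for which no
-- coefficient or sequence is defined.

f : ℕ → ℤ
f 1 = - + 8
f 2 = + 104
f 3 = - + 3520
f _ = 0ℤ

g : ℕ → ℤ
g 1 = 0ℤ
g 2 = - + (2 ^ 14)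
g 3 = - + (2 ^ 22)
g _ = 0ℤ

B : (k α : ℕ) → ℤ
B 1 = recurrence (f 1) (g 1) 0ℤ 0ℤ 0ℤ 0ℤ
B 2 = recurrence (f 2) (g 2) 0ℤ (+ 1) (- + 2048) (+ 104)
B 3 = recurrence (f 3) (g 3) 0ℤ (- + 24) (+ 49152) (+ 84480)
B _ = λ _ → 0ℤ

h : ℕ → ℤ
h 3 = - + 12
h 4 = - + (2 ℕ.* 3 ^ 2 ℕ.* 19)
h 5 = + (2 ^ 2 ℕ.* 3 ^ 3 ℕ.* 17)
h 6 = - + (2 ℕ.* 3 ^ 2 ℕ.* 17 ℕ.* 23)
h 7 = + (2 ^ 2 ℕ.* 3 ^ 3 ℕ.* 491)
h 8 = - + (2 ℕ.* 3 ^ 4 ℕ.* 5 ℕ.* 359)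
h _ = 0ℤ

r : ℕ → ℤ
r 3 = - + (3 ^ 7)
r 4 = - + (3 ^ 10)
r 5 = - + (3 ^ 13)
r 6 = - + (3 ^ 16)
r 7 = - + (3 ^ 19)
r 8 = - + (3 ^ 22)
r _ = 0ℤ

D : (k i β : ℕ) → ℤ
D 3 1 = recurrence (h 3) (r 3) 0ℤ (+ 1) (- + 243) (- + 12)
D 4 1 = recurrence (h 4) (r 4) 0ℤ (- + 12) (+ 2916) (+ 4104)
D 5 1 = recurrence (h 5) (r 5) 0ℤ (+ 90) (- + 21870) (+ 165240)
D 6 1 = recurrence (h 6) (r 6) 0ℤ (- + 486) (+ 118098) (+ 3420468)
D 6 2 = recurrence (h 6) (r 6) 0ℤ (+ 1) (- + 177147) (- + 7038)
D 7 1 = recurrence (h 7) (r 7) 0ℤ (+ 1701) (- + 413343) (+ 90200628)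
D 7 2 = recurrence (h 7) (r 7) 0ℤ (- + 21) (+ 3720087) (- + 1113588)
D 8 1 = recurrence (h 8) (r 8) 0ℤ 0ℤ 0ℤ 0ℤ
D 8 2 = recurrence (h 8) (r 8) 0ℤ (+ 252) (- + 44641044) (- + 73279080)
D _ _ = λ _ → 0ℤ

IsMinimum : (ℕ → Set) → ℕ → Set
IsMinimum P n = P n × (∀ j → P j → n ℕ.≤ j)

{-# OPTIONS --safe #-}
-- On odd indices each sequence is b · U, where U is the Lucas sequence with
-- U 0 = 0, U 1 = 1, U (n + 2) = p U (n + 1) + q U n, so it suffices to find
-- n ≥ 1 with m ∣ U n. By pigeonhole U agrees mod m with its shift by some
-- P ≥ 1 from an index i on, and running the recurrence backwards gives
-- m ∣ qⁱ U P. The prime c of which q is ± a power also divides p, so qⁱ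
-- divides U n for all large n. For a large multiple n of P, the duplication formula
-- writes U (2n) as U n times a factor divisible by qⁱ, while U P ∣ U n; hence
-- m ∣ U (2n).
-- (B 1, where q = 0 defeats this argument, is identically zero.)
module Submission where

open import Data.Fin.Base using (Fin; toℕ; fromℕ<; combine)
open import Data.Fin.Properties using (pigeonhole; combine-injective; fromℕ<-injective)
open import Data.Integer.Base as ℤ using (ℤ; +_; 0ℤ; 1ℤ)
open import Data.Integer.DivMod using (_%ℕ_; _/ℕ_; n%ℕd<d; a≡a%ℕn+[a/ℕn]*n)
open import Data.Integer.Divisibility using (_∣_)
open import Data.Integer.Divisibility.Signed
  using (divides; ∣⇒∣ᵤ; ∣-refl; ∣-trans; ∣m∣n⇒∣m+n; ∣m+n∣m⇒∣n; ∣n⇒∣m*n; ∣m⇒∣m*n;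
         *-monoʳ-∣; *-monoˡ-∣)
  renaming (_∣_ to _∣ₛ_)
open import Data.Integer.Properties using (*-comm; *-assoc; *-identityʳ; *-identityˡ; ^-*-assoc)
open import Data.Integer.Tactic.RingSolver using (solve-∀)
open import Data.Nat.Base as ℕ using (ℕ; zero; suc; _≤_; _<_; _*_; _∸_; _/_; z≤n; s≤s; NonZero)
open import Data.Nat.Divisibility using (_∣?_; _∣0)
open import Data.Nat.Induction using (<-rec)
open import Data.Nat.Properties as ℕ using (_≤?_; anyUpTo?; allUpTo?; ≮⇒≥; m≤n⇒∃[o]m+o≡n)
open import Data.Product.Base using (_×_; _,_; ∃-syntax)
open import Relation.Binary.PropositionalEquality
  using (_≡_; refl; sym; trans; cong; cong₂; subst; module ≡-Reasoning)
open import Relation.Nullary using (yes; no)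
open import Relation.Nullary.Decidable using (_×-dec_; _→-dec_; map′)
open import Relation.Unary using (Decidable)
open import Defs

-- Any witness suffices: while the bounded search finds a smaller one, descend to it; if none is
-- found, the current one is least.
minimum : {P : ℕ → Set} → Decidable P → ∃[ n ] P n → ∃[ n ] IsMinimum P n
minimum {P} P? (n , Pn) = <-rec (λ n → P n → ∃[ k ] IsMinimum P k) step n Pn
  where
  step : ∀ n → (∀ {j} → j < n → P j → ∃[ k ] IsMinimum P k) → P n → ∃[ k ] IsMinimum P k
  step n rec Pn with anyUpTo? P? n
  ... | yes (j , j<n , Pj) = rec j<n Pj
  ... | no ∄j = n , Pn , λ j Pj → ≮⇒≥ λ j<n → ∄j (j , j<n , Pj)

%ℕ-injective-mod : ∀ m .{{_ : NonZero m}} x y → x %ℕ m ≡ y %ℕ m → + m ∣ₛ y ℤ.- x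
%ℕ-injective-mod m x y eq = divides (y /ℕ m ℤ.- x /ℕ m) (begin
  y ℤ.- x
    ≡⟨ cong₂ ℤ._-_ (a≡a%ℕn+[a/ℕn]*n y m) (a≡a%ℕn+[a/ℕn]*n x m) ⟩
  (+ (y %ℕ m) ℤ.+ y /ℕ m ℤ.* + m) ℤ.- (+ (x %ℕ m) ℤ.+ x /ℕ m ℤ.* + m)
    ≡⟨ cong (λ z → (+ (y %ℕ m) ℤ.+ y /ℕ m ℤ.* + m) ℤ.- (+ z ℤ.+ x /ℕ m ℤ.* + m)) eq ⟩
  (+ (y %ℕ m) ℤ.+ y /ℕ m ℤ.* + m) ℤ.- (+ (y %ℕ m) ℤ.+ x /ℕ m ℤ.* + m)
    ≡⟨ cancel (+ (y %ℕ m)) (y /ℕ m) (x /ℕ m) (+ m) ⟩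
  (y /ℕ m ℤ.- x /ℕ m) ℤ.* + m ∎)
  where
  open ≡-Reasoning
  cancel : ∀ a b c d → (a ℤ.+ b ℤ.* d) ℤ.- (a ℤ.+ c ℤ.* d) ≡ (b ℤ.- c) ℤ.* d
  cancel = solve-∀

^-monoˡ-∣ : ∀ {a b} n → a ∣ₛ b → a ℤ.^ n ∣ₛ b ℤ.^ n
^-monoˡ-∣ zero a∣b = ∣-refl
^-monoˡ-∣ {a} {b} (suc n) a∣b =
  ∣-trans (*-monoˡ-∣ (a ℤ.^ n) a∣b) (*-monoʳ-∣ b (^-monoˡ-∣ n a∣b))

-- Divisibility in Lucas sequences

module Lucas (p q : ℤ) where

  U : ℕ → ℤ
  U 0 = 0ℤ
  U 1 = 1ℤ
  U (suc (suc n)) = p ℤ.* U (suc n) ℤ.+ q ℤ.* U n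

  -- For fixed `m` both sides obey the recurrence in `n`, so agreement at two consecutive indices is
  -- enough.
  U-add : ∀ n m → U (suc n ℕ.+ m) ≡ U (suc n) ℤ.* U (suc m) ℤ.+ q ℤ.* (U n ℤ.* U m)
  U-add 0 m = lemma q (U (suc m)) (U m)
    where
    lemma : ∀ q a b → a ≡ 1ℤ ℤ.* a ℤ.+ q ℤ.* (0ℤ ℤ.* b)
    lemma = solve-∀
  U-add 1 m = lemma p q (U (suc m)) (U m)
    where
    lemma : ∀ p q a b → p ℤ.* a ℤ.+ q ℤ.* b ≡ (p ℤ.* 1ℤ ℤ.+ q ℤ.* 0ℤ) ℤ.* a ℤ.+ q ℤ.* (1ℤ ℤ.* b)
    lemma = solve-∀
  U-add (suc (suc n)) m = trans
    (cong₂ (λ x y → p ℤ.* x ℤ.+ q ℤ.* y) (U-add (suc n) m) (U-add n m))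
    (lemma p q (U (suc n)) (U n) (U (suc m)) (U m))
    where
    lemma : ∀ p q u v a b →
      p ℤ.* ((p ℤ.* u ℤ.+ q ℤ.* v) ℤ.* a ℤ.+ q ℤ.* (u ℤ.* b)) ℤ.+ q ℤ.* (u ℤ.* a ℤ.+ q ℤ.* (v ℤ.* b))
      ≡ (p ℤ.* (p ℤ.* u ℤ.+ q ℤ.* v) ℤ.+ q ℤ.* u) ℤ.* a ℤ.+ q ℤ.* ((p ℤ.* u ℤ.+ q ℤ.* v) ℤ.* b)
    lemma = solve-∀

  U-double : ∀ n → U (suc n ℕ.+ suc n) ≡ U (suc n) ℤ.* (U (suc (suc n)) ℤ.+ q ℤ.* U n)
  U-double n = trans (U-add n (suc n)) (lemma q (U (suc n)) (U (suc (suc n))) (U n))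
    where
    lemma : ∀ q a b c → a ℤ.* b ℤ.+ q ℤ.* (c ℤ.* a) ≡ a ℤ.* (b ℤ.+ q ℤ.* c)
    lemma = solve-∀

  U-∣-multiple : ∀ n t → U (suc n) ∣ₛ U (t * suc n)
  U-∣-multiple n zero = divides 0ℤ refl
  U-∣-multiple n (suc t) = subst (U (suc n) ∣ₛ_) (sym (U-add n (t * suc n)))
    (∣m∣n⇒∣m+n (∣m⇒∣m*n (U (suc (t * suc n))) ∣-refl)
      (∣n⇒∣m*n q (∣n⇒∣m*n (U n) (U-∣-multiple n t))))

  -- The recurrence is run backwards without dividing by `q`: each step down moves one factor `q`
  -- into the accumulator `a`. At index 0 the difference is `U P` itself, because `U 0` vanishes.
  shift-∣ : ∀ {m} P i a →
    m ∣ₛ a ℤ.* (U (i ℕ.+ P) ℤ.- U i) → m ∣ₛ a ℤ.* (U (suc i ℕ.+ P) ℤ.- U (suc i)) →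
    m ∣ₛ (a ℤ.* q ℤ.^ i) ℤ.* U P
  shift-∣ {m} P zero a d₀ _ = subst (m ∣ₛ_) (lemma a (U P)) d₀
    where
    lemma : ∀ a u → a ℤ.* (u ℤ.- 0ℤ) ≡ (a ℤ.* 1ℤ) ℤ.* u
    lemma = solve-∀
  shift-∣ {m} P (suc i) a d₁ d₂ =
    subst (λ z → m ∣ₛ z ℤ.* U P) (*-assoc a q (q ℤ.^ i))
      (shift-∣ P i (a ℤ.* q)
        -- Removing `p` times the difference at `suc i` from the one at `suc (suc i)` leaves `q`
        -- times the difference at `i`.
        (∣m+n∣m⇒∣n (subst (m ∣ₛ_) (back a p q _ _ _ _) d₂) (∣n⇒∣m*n p d₁))
        (subst (m ∣ₛ_) (commute a q _) (∣n⇒∣m*n q d₁)))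
    where
    back : ∀ a p q x y u v →
      a ℤ.* ((p ℤ.* x ℤ.+ q ℤ.* y) ℤ.- (p ℤ.* u ℤ.+ q ℤ.* v))
      ≡ p ℤ.* (a ℤ.* (x ℤ.- u)) ℤ.+ (a ℤ.* q) ℤ.* (y ℤ.- v)
    back = solve-∀
    commute : ∀ a q x → q ℤ.* (a ℤ.* x) ≡ (a ℤ.* q) ℤ.* x
    commute = solve-∀

  residue : ∀ m .{{_ : NonZero m}} → ℕ → Fin m
  residue m n = fromℕ< (n%ℕd<d (U n) m)

  q-power-multiple : ∀ m .{{_ : NonZero m}} → ∃[ i ] ∃[ P ] + m ∣ₛ q ℤ.^ i ℤ.* U (suc P)
  q-power-multiple m
    -- Pairs of consecutive residues determine the sequence mod `m`; there are `m * m` pairs, so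
    -- `suc (m * m)` indices force a repetition.
    with i , j , i<j , eq ← pigeonhole (ℕ.n<1+n (m * m))
           (λ (i : Fin (suc (m * m))) → combine (residue m (toℕ i)) (residue m (suc (toℕ i))))
    with eq₀ , eq₁ ← combine-injective (residue m (toℕ i)) (residue m (suc (toℕ i)))
                       (residue m (toℕ j)) (residue m (suc (toℕ j))) eq
    with P , 1+i+P≡j ← m≤n⇒∃[o]m+o≡n i<j
    = toℕ i , P , subst (λ z → + m ∣ₛ z ℤ.* U (suc P)) (*-identityˡ (q ℤ.^ toℕ i))
        (shift-∣ (suc P) (toℕ i) 1ℤ (agree (toℕ i) (toℕ j) j≡ eq₀)
          (agree (suc (toℕ i)) (suc (toℕ j)) (cong suc j≡) eq₁))
    where
    j≡ : toℕ j ≡ toℕ i ℕ.+ suc P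
    j≡ = trans (sym 1+i+P≡j) (sym (ℕ.+-suc (toℕ i) P))
    agree : ∀ a b → b ≡ a ℕ.+ suc P → residue m a ≡ residue m b → + m ∣ₛ 1ℤ ℤ.* (U (a ℕ.+ suc P) ℤ.- U a)
    agree a b refl eq = ∣n⇒∣m*n 1ℤ (%ℕ-injective-mod m (U a) (U b) (fromℕ<-injective _ _ _ _ eq))

  module _ (c : ℤ) (c∣p : c ∣ₛ p) (c∣q : c ∣ₛ q) where

    -- Both coefficients contribute a factor `c`, so a power dividing two consecutive terms is
    -- raised by one in the next term. The exponent thus grows by one for every two indices.
    ^-∣-U : ∀ N n → N * 2 < n → c ℤ.^ N ∣ₛ U n
    ^-∣-U zero n _ = divides (U n) (sym (*-identityʳ (U n)))
    ^-∣-U (suc N) (suc (suc n)) (s≤s (s≤s N*2<n)) =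
      ∣m∣n⇒∣m+n (mult c∣p (^-∣-U N (suc n) (ℕ.m≤n⇒m≤1+n N*2<n))) (mult c∣q (^-∣-U N n N*2<n))
      where
      mult : ∀ {x y} → c ∣ₛ x → c ℤ.^ N ∣ₛ y → c ℤ.* c ℤ.^ N ∣ₛ x ℤ.* y
      mult {x} c∣x d = ∣-trans (*-monoˡ-∣ (c ℤ.^ N) c∣x) (*-monoʳ-∣ x d)

    module _ (e : ℕ) (q∣cᵉ : q ∣ₛ c ℤ.^ e) where

      q^-∣-U : ∀ i n → e * i * 2 < n → q ℤ.^ i ∣ₛ U n
      q^-∣-U i n large = ∣-trans (^-monoˡ-∣ i q∣cᵉ)
        (subst (_∣ₛ U n) (sym (^-*-assoc c e i)) (^-∣-U (e * i) n large))

      rank-exists : ∀ m .{{_ : NonZero m}} → ∃[ n ] + m ∣ₛ U (suc n)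
      rank-exists m with i , P , m∣qⁱU ← q-power-multiple m =
        n ℕ.+ suc n , ∣-trans m∣qⁱU (subst (_ ∣ₛ_) (trans (*-comm V (U (suc n))) (sym (U-double n)))
          (∣-trans (*-monoˡ-∣ (U (suc P)) qⁱ∣V) (*-monoʳ-∣ V (U-∣-multiple P (suc (suc N))))))
        where
        -- `N ≤ n` is exactly the bound `e * i * 2 < n` that `q^-∣-U` needs, and `suc n` unfolds to
        -- `suc (suc N) * suc P`, a multiple of `suc P`. `V` is the cofactor in `U-double`, the
        -- companion Lucas number at `suc n`.
        N = suc (e * i * 2)
        n = P ℕ.+ suc N * suc P
        V = U (suc (suc n)) ℤ.+ q ℤ.* U n
        N≤n : N ≤ n
        N≤n = ℕ.≤-trans (ℕ.n≤1+n N) (ℕ.≤-trans (ℕ.m≤m*n (suc N) (suc P)) (ℕ.m≤n+m _ P))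
        qⁱ∣V : q ℤ.^ i ∣ₛ V
        qⁱ∣V = ∣m∣n⇒∣m+n (q^-∣-U i (suc (suc n)) (ℕ.m≤n⇒m≤1+n (ℕ.m≤n⇒m≤1+n N≤n)))
                 (∣n⇒∣m*n q (q^-∣-U i n N≤n))

  -- The fourth initial value is fixed as `p ℤ.* b`, which makes the odd-indexed terms start as `b`
  -- times 1 and `p`, the values of `U` at 1 and 2. The tables fit this form by computation.
  recurrence-odd : ∀ a b c n → recurrence p q a b c (p ℤ.* b) (suc (n * 2)) ≡ b ℤ.* U (suc n)
  recurrence-odd a b c 0 = sym (*-identityʳ b)
  recurrence-odd a b c 1 = lemma p q b
    where
    lemma : ∀ p q b → p ℤ.* b ≡ b ℤ.* (p ℤ.* 1ℤ ℤ.+ q ℤ.* 0ℤ)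
    lemma = solve-∀
  recurrence-odd a b c (suc (suc n)) = trans
    (cong₂ (λ x y → p ℤ.* x ℤ.+ q ℤ.* y) (recurrence-odd a b c (suc n)) (recurrence-odd a b c n))
    (lemma p q b (U (suc (suc n))) (U (suc n)))
    where
    lemma : ∀ p q b x y → p ℤ.* (b ℤ.* x) ℤ.+ q ℤ.* (b ℤ.* y) ≡ b ℤ.* (p ℤ.* x ℤ.+ q ℤ.* y)
    lemma = solve-∀

  recurrence-∣ : ∀ {m a c} b n → m ∣ₛ U (suc n) → m ∣ recurrence p q a b c (p ℤ.* b) (2 * suc n ∸ 1)
  recurrence-∣ {m} {a} {c} b n d = ∣⇒∣ᵤ (subst (m ∣ₛ_)
    (trans (sym (recurrence-odd a b c n))
      (cong (λ z → recurrence p q a b c (p ℤ.* b) (z ∸ 1)) (ℕ.*-comm (suc n) 2)))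
    (∣n⇒∣m*n b d))

-- The tabulated sequences

open Lucas using (rank-exists; recurrence-∣)

B-vanishes : ∀ m .{{_ : NonZero m}} k → 1 ≤ k → k ≤ 3 →
  ∃[ α ] (1 ≤ α × + m ∣ B k (2 * α ∸ 1))
B-vanishes m 1 _ _ = 1 , s≤s z≤n , m ∣0
B-vanishes m 2 _ _ =
  -- Here `c` is 2: the quotients witness 104 = 52 · 2 and the divisibility of the second
  -- coefficient by 2. That coefficient is minus the 14th power of 2, so it divides this power with
  -- quotient -1.
  let n , d = rank-exists (f 2) (g 2) (+ 2) (divides (+ 52) refl) (divides (ℤ.- + (2 ℕ.^ 13)) refl)
                 14 (divides (ℤ.- + 1) refl) m
  in suc n , s≤s z≤n , recurrence-∣ (f 2) (g 2) (+ 1) n d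
B-vanishes m 3 _ _ =
  let n , d = rank-exists (f 3) (g 3) (+ 2) (divides (ℤ.- + 1760) refl) (divides (ℤ.- + (2 ℕ.^ 21)) refl)
                 22 (divides (ℤ.- + 1) refl) m
  in suc n , s≤s z≤n , recurrence-∣ (f 3) (g 3) (ℤ.- + 24) n d
B-vanishes m (suc (suc (suc (suc _)))) _ (s≤s (s≤s (s≤s ())))

-- For fixed `k` all the sequences share their coefficients, hence their `U`, so one index serves
-- every `i`. From `k = 3` on the common divisor is 3; for `k` below 3 the range of `i` is empty.
D-vanishes : ∀ m .{{_ : NonZero m}} k → 1 ≤ k → k ≤ 8 →
  ∃[ β ] (1 ≤ β × (∀ i → 1 ≤ i → i ≤ k / 3 → + m ∣ D k i (2 * β ∸ 1)))
D-vanishes m 1 _ _ = 1 , s≤s z≤n , λ { (suc _) _ () }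
D-vanishes m 2 _ _ = 1 , s≤s z≤n , λ { (suc _) _ () }
D-vanishes m 3 _ _ =
  let n , d = rank-exists (h 3) (r 3) (+ 3) (divides (ℤ.- + 4) refl) (divides (ℤ.- + (3 ℕ.^ 6)) refl)
                 7 (divides (ℤ.- + 1) refl) m
  in suc n , s≤s z≤n , λ where
      1 _ _ → recurrence-∣ (h 3) (r 3) (+ 1) n d
      (suc (suc _)) _ (s≤s ())
D-vanishes m 4 _ _ =
  let n , d = rank-exists (h 4) (r 4) (+ 3) (divides (ℤ.- + 114) refl) (divides (ℤ.- + (3 ℕ.^ 9)) refl)
                 10 (divides (ℤ.- + 1) refl) m
  in suc n , s≤s z≤n , λ where
      1 _ _ → recurrence-∣ (h 4) (r 4) (ℤ.- + 12) n d
      (suc (suc _)) _ (s≤s ())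
D-vanishes m 5 _ _ =
  let n , d = rank-exists (h 5) (r 5) (+ 3) (divides (+ 612) refl) (divides (ℤ.- + (3 ℕ.^ 12)) refl)
                 13 (divides (ℤ.- + 1) refl) m
  in suc n , s≤s z≤n , λ where
      1 _ _ → recurrence-∣ (h 5) (r 5) (+ 90) n d
      (suc (suc _)) _ (s≤s ())
D-vanishes m 6 _ _ =
  let n , d = rank-exists (h 6) (r 6) (+ 3) (divides (ℤ.- + 2346) refl) (divides (ℤ.- + (3 ℕ.^ 15)) refl)
                 16 (divides (ℤ.- + 1) refl) m
  in suc n , s≤s z≤n , λ where
      1 _ _ → recurrence-∣ (h 6) (r 6) (ℤ.- + 486) n d
      2 _ _ → recurrence-∣ (h 6) (r 6) (+ 1) n d
      (suc (suc (suc _))) _ (s≤s (s≤s ()))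
D-vanishes m 7 _ _ =
  let n , d = rank-exists (h 7) (r 7) (+ 3) (divides (+ 17676) refl) (divides (ℤ.- + (3 ℕ.^ 18)) refl)
                 19 (divides (ℤ.- + 1) refl) m
  in suc n , s≤s z≤n , λ where
      1 _ _ → recurrence-∣ (h 7) (r 7) (+ 1701) n d
      2 _ _ → recurrence-∣ (h 7) (r 7) (ℤ.- + 21) n d
      (suc (suc (suc _))) _ (s≤s (s≤s ()))
D-vanishes m 8 _ _ =
  let n , d = rank-exists (h 8) (r 8) (+ 3) (divides (ℤ.- + 96930) refl) (divides (ℤ.- + (3 ℕ.^ 21)) refl)
                 22 (divides (ℤ.- + 1) refl) m
  in suc n , s≤s z≤n , λ where
      -- The zero sequence fits as the multiple 0 of `U`.
      1 _ _ → recurrence-∣ (h 8) (r 8) 0ℤ n d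
      2 _ _ → recurrence-∣ (h 8) (r 8) (+ 252) n d
      (suc (suc (suc _))) _ (s≤s (s≤s ()))
D-vanishes m (suc (suc (suc (suc (suc (suc (suc (suc (suc _))))))))) _
  (s≤s (s≤s (s≤s (s≤s (s≤s (s≤s (s≤s (s≤s ()))))))))

theorem3p2 : (m : ℕ) → 2 ≤ m →
    (∀ k → 1 ≤ k → k ≤ 3 →
    ∃[ μ ] IsMinimum (λ α → 1 ≤ α × + m ∣ B k (2 * α ∸ 1)) μ)
    ×
    (∀ k → 1 ≤ k → k ≤ 8 →
    ∃[ ν ] IsMinimum (λ β → 1 ≤ β × (∀ i → 1 ≤ i → i ≤ k / 3 → + m ∣ D k i (2 * β ∸ 1))) ν)
theorem3p2 m@(suc _) _ =
  (λ k 1≤k k≤3 → minimum (λ α → 1 ≤? α ×-dec m ∣? ℤ.∣ B k (2 * α ∸ 1) ∣) (B-vanishes m k 1≤k k≤3)) ,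
  (λ k 1≤k k≤8 → minimum (λ β → 1 ≤? β ×-dec bounded? k β) (D-vanishes m k 1≤k k≤8))
  where
  bounded? : ∀ k → Decidable λ β → ∀ i → 1 ≤ i → i ≤ k / 3 → + m ∣ D k i (2 * β ∸ 1)
  bounded? k β = map′ (λ all i 1≤i i≤ → all {i} (s≤s i≤) 1≤i) (λ all {i} i< 1≤i → all i 1≤i (ℕ.s≤s⁻¹ i<))
    -- The search runs over `i < suc (k / 3)`, so that `k / 3` itself is included.
    (allUpTo? (λ i → 1 ≤? i →-dec m ∣? ℤ.∣ D k i (2 * β ∸ 1) ∣) (suc (k / 3)))
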